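{- Let $n\ge1$ and $1\le M\le 2^{n-1}$ be integers and set $a:=M/2^{n}$ (so $0<a\le 1/2$). Then every $A\subseteq\{ -1,1\}^{n}$ with $|A|=M$ satisfies \[ D(A)\;\ge\;\frac{n}{2}-\varphi(a),\qquad\text{where }\ \varphi(a):=\begin{cases}\frac{1}{\sqrt{a}}-1, & 0< a\le\frac14,\\[2pt] \frac{1}{4a}, & \frac14<a\le\frac12.\end{cases} \]
   Context: For a nonempty set (code) $A\subseteq\{ -1,1\}^{n}$, its average distance is $D(A):=\frac{1}{|A|^{2}}\sum_{(\mathbf{x},\mathbf{x}')\in A^{2}}d_{\mathrm{H}}(\mathbf{x},\mathbf{x}')$, where $d_{\mathrm{H}}(\mathbf{x},\mathbf{x}')=|\{i:x_i\neq x_i'\}|$ is the Hamming distance. -}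

module Defs where

open import Data.Bool using (Bool; T?)
open import Data.Integer as ℤ using (+_)
import Data.Integer.Properties as ℤ
open import Data.List using (List; []; _∷_; map; filter; length; cartesianProduct; cartesianProductWith)
import Data.Nat as ℕ
open import Data.Nat.ListAction using (sum)
open import Data.Nat using (ℕ; zero; suc)
open import Data.Nat.Coprimality using (1-coprimeTo) renaming (sym to coprime-sym)
import Data.Nat.Properties as ℕ
open import Data.Product using (∃; ∃-syntax; _×_; _,_; uncurry)
open import Data.Rational using (ℚ; mkℚ; _+_; _-_; -_; _*_; _/_; 1/_; _<_; _≤_; 0ℚ; 1ℚ; ½; Positive; positive; >-nonZero; nonNegative; toℚᵘ; *<*)
open import Data.Rational.Properties
open import Data.Rational.Solver using (module +-*-Solver)
import Data.Rational.Unnormalised as ℚᵘ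
import Data.Rational.Unnormalised.Properties as ℚᵘ
open import Data.Sign using (Sign)
import Data.Sign.Properties as Sign
open import Data.Sum using (_⊎_; inj₁; inj₂)
open import Data.Vec using (Vec; zip; count) renaming ([] to []ᵛ; _∷_ to _∷ᵛ_)
open import Function using (_∘_)
open import Relation.Binary.Definitions using (tri<; tri≈; tri>)
open import Relation.Binary.PropositionalEquality using (_≡_; refl; sym; trans; cong; subst; subst₂)
open import Relation.Nullary using (¬_; yes; no; ¬?)
open import Relation.Nullary.Negation using (contradiction)

open +-*-Solver using (solve; _:+_; _:-_; _:*_; :-_; con; _:=_)

Cube : ℕ → Set
Cube n = Vec Sign n

-- As in Data.Fin.Subset, a subset of a finite type is its Boolean
-- indicator function.
Code : ℕ → Set
Code n = Cube n → Bool

cube : ∀ n → List (Cube n)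
cube zero    = []ᵛ ∷ []
cube (suc n) = cartesianProductWith _∷ᵛ_ (Sign.- ∷ Sign.+ ∷ []) (cube n)

elements : ∀ {n} → Code n → List (Cube n)
elements {n} A = filter (T? ∘ A) (cube n)

∣_∣ : ∀ {n} → Code n → ℕ
∣ A ∣ = length (elements A)

dᴴ : ∀ {n} → Cube n → Cube n → ℕ
dᴴ x x′ = count (λ (s , t) → ¬? (s Sign.≟ t)) (zip x x′)

D : ∀ {n} (A : Code n) → .{{ℕ.NonZero ∣ A ∣}} → ℚ
D A = _/_ (+ sum (map (uncurry dᴴ) (cartesianProduct (elements A) (elements A))))
          (∣ A ∣ ℕ.^ 2) {{ℕ.m^n≢0 ∣ A ∣ 2}}

nonEmpty : ∀ {n M} {A : Code n} → 1 ℕ.≤ M → ∣ A ∣ ≡ M → ℕ.NonZero ∣ A ∣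
nonEmpty 1≤M ∣A∣≡M = ℕ.>-nonZero (subst (1 ℕ.≤_) (sym ∣A∣≡M) 1≤M)

density : ℕ → ℕ → ℚ
density n M = _/_ (+ M) (2 ℕ.^ n) {{ℕ.m^n≢0 2 n}}

density-positive : ∀ n {M} → 1 ℕ.≤ M → Positive (density n M)
density-positive n {M} 1≤M = normalize-pos M (2 ℕ.^ n) {{ℕ.m^n≢0 2 n}} {{ℕ.>-nonZero 1≤M}}

-- L and U are the sets of rationals strictly below, respectively
-- strictly above, the number.
record ℝ : Set₁ where
  field
    L U      : ℚ → Set
    L-inhab  : ∃ L
    U-inhab  : ∃ U
    L-closed : ∀ {p q} → p < q → L q → L p
    U-closed : ∀ {p q} → p < q → U p → U q
    L-open   : ∀ {p} → L p → ∃[ q ] (p < q × L q)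
    U-open   : ∀ {q} → U q → ∃[ p ] (p < q × U p)
    disjoint : ∀ {p} → L p → ¬ U p
    located  : ∀ {p q} → p < q → L p ⊎ U q

open ℝ

infix 4 _≤ᴿ_ _≥ᴿ_

_≤ᴿ_ _≥ᴿ_ : ℝ → ℝ → Set
x ≤ᴿ y = ∀ {q} → L x q → L y q
x ≥ᴿ y = y ≤ᴿ x

L<U : ∀ x {p q} → L x p → U x q → p < q
L<U x {p} {q} l u with <-cmp p q
... | tri< p<q _ _    = p<q
... | tri≈ _ refl _   = contradiction u (disjoint x l)
... | tri> _ _ q<p    = contradiction u (disjoint x (L-closed x q<p l))

private abstract

  -- Reduces a strict inequality to a ring identity between differences.
  shift : ∀ {a b p q} → a < b → b - a ≡ q - p → p < q
  shift {a} {b} {p} {q} a<b eq = subst₂ _<_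
    (solve 2 (λ a p → a :+ (p :- a) := p) refl a p)
    (trans (solve 3 (λ a b p → b :+ (p :- a) := (b :- a) :+ p) refl a b p)
      (trans (cong (_+ p) eq) (solve 2 (λ p q → (q :- p) :+ p := q) refl p q)))
    (+-monoˡ-< (p - a) a<b)

  p-1<p : ∀ p → p - 1ℚ < p
  p-1<p p = shift (positive⁻¹ 1ℚ) (solve 1 (λ p → con 1ℚ :- con 0ℚ := p :- (p :- con 1ℚ)) refl p)

  p<p+1 : ∀ p → p < p + 1ℚ
  p<p+1 p = shift (positive⁻¹ 1ℚ) (solve 1 (λ p → con 1ℚ :- con 0ℚ := (p :+ con 1ℚ) :- p) refl p)

  0<q-p : ∀ {p q} → p < q → 0ℚ < q - p
  0<q-p {p} {q} p<q = shift p<q (solve 2 (λ p q → q :- p := (q :- p) :- con 0ℚ) refl p q)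

  *-pos : ∀ {p q} → 0ℚ < p → 0ℚ < q → 0ℚ < p * q
  *-pos {p} {q} 0<p 0<q = positive⁻¹ (p * q) {{pos*pos⇒pos p {{positive 0<p}} q {{positive 0<q}}}}

  *-monoˡ : ∀ {p q r} → 0ℚ < r → p < q → p * r < q * r
  *-monoˡ {r = r} 0<r = *-monoˡ-<-pos r {{positive 0<r}}

  *-cancel : ∀ {p q r} → 0ℚ < r → p * r < q * r → p < q
  *-cancel {r = r} 0<r = *-cancelʳ-<-nonNeg r {{nonNegative (<⇒≤ 0<r)}}

  inverse : ∀ {r} → 0ℚ < r → ∃[ s ] (0ℚ < s × s * r ≡ 1ℚ)
  inverse {r} 0<r = (1/ r) {{>-nonZero 0<r}} ,
    positive⁻¹ _ {{1/pos⇒pos r {{positive 0<r}}}} , *-inverseˡ r {{>-nonZero 0<r}}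

  divide : ∀ p {r} → 0ℚ < r → ∃[ q ] q * r ≡ p
  divide p {r} 0<r with s , _ , sr≡1 ← inverse 0<r =
    p * s , trans (*-assoc p s r) (trans (cong (p *_) sr≡1) (*-identityʳ p))

  square-mono : ∀ {p q} → 0ℚ ≤ p → p < q → p * p < q * q
  square-mono {p} {q} 0≤p p<q = ≤-<-trans
    (*-monoˡ-≤-nonNeg p {{nonNegative 0≤p}} (<⇒≤ p<q))
    (*-monoˡ (≤-<-trans 0≤p p<q) p<q)

  neg-involutive : ∀ p → - (- p) ≡ p
  neg-involutive = solve 1 (λ p → :- (:- p) := p) refl

infix 8 _ᴿ

_ᴿ : ℚ → ℝ
(q ᴿ) .L p = p < q
(q ᴿ) .U p = q < p
(q ᴿ) .L-inhab = q - 1ℚ , p-1<p q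
(q ᴿ) .U-inhab = q + 1ℚ , p<p+1 q
(q ᴿ) .L-closed = <-trans
(q ᴿ) .U-closed p<r q<p = <-trans q<p p<r
(q ᴿ) .L-open = <-dense
(q ᴿ) .U-open q<p with r , q<r , r<p ← <-dense q<p = r , r<p , q<r
(q ᴿ) .disjoint = <-asym
(q ᴿ) .located {p} {r} p<r with p <? q
... | yes p<q = inj₁ p<q
... | no  p≮q = inj₂ (≤-<-trans (≮⇒≥ p≮q) p<r)

-ᴿ_ : ℝ → ℝ
(-ᴿ x) .L p = U x (- p)
(-ᴿ x) .U p = L x (- p)
(-ᴿ x) .L-inhab with u , h ← U-inhab x = - u , subst (U x) (sym (neg-involutive u)) h
(-ᴿ x) .U-inhab with l , h ← L-inhab x = - l , subst (L x) (sym (neg-involutive l)) h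
(-ᴿ x) .L-closed p<q = U-closed x (neg-antimono-< p<q)
(-ᴿ x) .U-closed p<q = L-closed x (neg-antimono-< p<q)
(-ᴿ x) .L-open {p} h with r , r<-p , u ← U-open x h =
  - r , subst (_< - r) (neg-involutive p) (neg-antimono-< r<-p) ,
  subst (U x) (sym (neg-involutive r)) u
(-ᴿ x) .U-open {q} h with r , -q<r , l ← L-open x h =
  - r , subst (- r <_) (neg-involutive q) (neg-antimono-< -q<r) ,
  subst (L x) (sym (neg-involutive r)) l
(-ᴿ x) .disjoint u l = disjoint x l u
(-ᴿ x) .located p<q with located x (neg-antimono-< p<q)
... | inj₁ l = inj₂ l
... | inj₂ u = inj₁ u

private

  infixr 8 _·_
  _·_ : ℕ → ℚ → ℚ
  zero  · d = 0ℚ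
  suc n · d = d + n · d

  ι : ℕ → ℚ
  ι n = mkℚ (+ n) 0 (coprime-sym (1-coprimeTo n))

private abstract

  ι-suc : ∀ n → ι (suc n) ≡ 1ℚ + ι n
  ι-suc n = toℚᵘ-injective (ℚᵘ.≃-trans
    (ℚᵘ.*≡* (cong (ℤ._* + 1) (cong (ℤ._+_ (+ 1)) (sym (ℤ.*-identityʳ (+ n))))))
    (ℚᵘ.≃-sym (toℚᵘ-homo-+ 1ℚ (ι n))))

  ι-· : ∀ n d → ι n * d ≡ n · d
  ι-· zero    d = *-zeroˡ d
  ι-· (suc n) d = trans (cong (_* d) (ι-suc n)) (trans (*-distribʳ-+ d 1ℚ (ι n))
    (trans (cong (_+ ι n * d) (*-identityˡ d)) (cong (λ z → d + z) (ι-· n d))))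

  <ι : ∀ q → ∃[ n ] q < ι n
  <ι q@(mkℚ i d _) = suc ℤ.∣ i ∣ , *<* (subst (ℤ._< (+ suc ℤ.∣ i ∣ ℤ.* + suc d)) (sym (ℤ.*-identityʳ i))
    (ℤ.≤-<-trans (i≤∣i∣ i) (ℤ.<-≤-trans (ℤ.+<+ (ℕ.n<1+n _)) (ℤ.+≤+ (ℕ.m≤m*n (suc ℤ.∣ i ∣) (suc d))))))
    where
    i≤∣i∣ : ∀ i → i ℤ.≤ + ℤ.∣ i ∣
    i≤∣i∣ (+ n)        = ℤ.≤-refl
    i≤∣i∣ (ℤ.-[1+ n ]) = ℤ.-≤+

  archimedes : ∀ q {d} → 0ℚ < d → ∃[ n ] q < n · d
  archimedes q {d} 0<d =
    let r , rd≡q = divide q 0<d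
        n , r<n  = <ι r
    in n , subst₂ _<_ rd≡q (ι-· n d) (*-monoˡ 0<d r<n)

  reach : ∀ l u m → u - l < m → u < l + m
  reach l u m h = shift {u - l} {m} {u} {l + m} h
    (solve 3 (λ l u m → m :- (u :- l) := (l :+ m) :- u) refl l u m)

  next : ∀ l d → 0ℚ < d → l + d < l + (d + d)
  next l d h = shift {0ℚ} {d} {l + d} {l + (d + d)} h
    (solve 2 (λ l d → d :- con 0ℚ := (l :+ (d :+ d)) :- (l :+ d)) refl l d)

  walk : ∀ x {d} → 0ℚ < d → ∀ n {l} → L x l → U x (l + n · d) → ∃[ a ] (L x a × U x (a + (d + d)))
  walk x {d} 0<d zero {l} hl hu = contradiction (subst (U x) (+-identityʳ l) hu) (disjoint x {l} hl)
  walk x {d} 0<d (suc n) {l} hl hu = go (located x (next l d 0<d))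
    where
    go : L x (l + d) ⊎ U x (l + (d + d)) → ∃[ a ] (L x a × U x (a + (d + d)))
    go (inj₁ h) = walk x 0<d n h (subst (U x) (sym (+-assoc l d (n · d))) hu)
    go (inj₂ h) = l , hl , h

  approx : ∀ x {d} → 0ℚ < d → ∃[ a ] (L x a × U x (a + (d + d)))
  approx x {d} 0<d =
    let l , hl = L-inhab x
        u , hu = U-inhab x
        n , u-l<nd = archimedes (u - l) 0<d
    in walk x 0<d n hl (U-closed x (reach l u (n · d) u-l<nd) hu)

  eighth : ℚ → ℚ → ℚ
  eighth p q = + 1 / 8 * (q - p)

  0<eighth : ∀ {p q} → p < q → 0ℚ < eighth p q
  0<eighth {p} {q} p<q = subst (_< eighth p q) (*-zeroʳ (+ 1 / 8)) (*-monoʳ-<-pos (+ 1 / 8) (0<q-p p<q))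

  split : ∀ a p q → p < q → p - a + eighth p q < q - a - (eighth p q + eighth p q + eighth p q)
  split a p q p<q = shift {0ℚ} {½ * (q - p)} half
    (solve 3 (λ a p q → let d = con (+ 1 / 8) :* (q :- p) in
      con ½ :* (q :- p) :- con 0ℚ := (q :- a :- (d :+ d :+ d)) :- (p :- a :+ d)) refl a p q)
    where
    half : 0ℚ < ½ * (q - p)
    half = subst (_< ½ * (q - p)) (*-zeroʳ ½) (*-monoʳ-<-pos ½ (0<q-p p<q))

  above : ∀ a p d → 0ℚ < d → p < a + (p - a + d)
  above a p d h = shift {0ℚ} {d} {p} {a + (p - a + d)} h
    (solve 3 (λ a p d → d :- con 0ℚ := (a :+ (p :- a :+ d)) :- p) refl a p d)

  below : ∀ a q d → 0ℚ < d → a + (d + d) + (q - a - (d + d + d)) < q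
  below a q d h = shift {0ℚ} {d} {a + (d + d) + (q - a - (d + d + d))} {q} h
    (solve 3 (λ a q d → d :- con 0ℚ :=
      q :- ((a :+ (d :+ d)) :+ (q :- a :- (d :+ d :+ d)))) refl a q d)

infixl 6 _+ᴿ_ _-ᴿ_

_+ᴿ_ : ℝ → ℝ → ℝ
(x +ᴿ y) .L p = ∃[ a ] ∃[ b ] (L x a × L y b × p < a + b)
(x +ᴿ y) .U p = ∃[ a ] ∃[ b ] (U x a × U y b × a + b < p)
(x +ᴿ y) .L-inhab with L-inhab x | L-inhab y
... | a , ha | b , hb = a + b - 1ℚ , a , b , ha , hb , p-1<p (a + b)
(x +ᴿ y) .U-inhab with U-inhab x | U-inhab y
... | a , ha | b , hb = a + b + 1ℚ , a , b , ha , hb , p<p+1 (a + b)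
(x +ᴿ y) .L-closed p<q (a , b , ha , hb , q<) = a , b , ha , hb , <-trans p<q q<
(x +ᴿ y) .U-closed p<q (a , b , ha , hb , <p) = a , b , ha , hb , <-trans <p p<q
(x +ᴿ y) .L-open (a , b , ha , hb , p<) with r , p<r , r< ← <-dense p< =
  r , p<r , a , b , ha , hb , r<
(x +ᴿ y) .U-open (a , b , ha , hb , <p) with r , <r , r<p ← <-dense <p =
  r , r<p , a , b , ha , hb , <r
(x +ᴿ y) .disjoint (a , b , ha , hb , p<) (c , d , hc , hd , <p) =
  <-asym (<-trans p< (+-mono-< (L<U x ha hc) (L<U y hb hd))) <p
(x +ᴿ y) .located {p} {q} p<q with a , la , ua ← approx x (0<eighth p<q)
  with located y (split a p q p<q)
... | inj₁ l = inj₁ (a , _ , la , l , above a p (eighth p q) (0<eighth p<q))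
... | inj₂ u = inj₂ (_ , _ , ua , u , below a q (eighth p q) (0<eighth p<q))

_-ᴿ_ : ℝ → ℝ → ℝ
x -ᴿ y = x +ᴿ (-ᴿ y)

-- Members of U x are positive here, so q * r < 1 holds for every q ≤ 0.
recip : (x : ℝ) → L x 0ℚ → ℝ
recip x 0<x .L q = ∃[ r ] (U x r × q * r < 1ℚ)
recip x 0<x .U q = ∃[ r ] (0ℚ < r × L x r × 1ℚ < q * r)
recip x 0<x .L-inhab with r , u ← U-inhab x =
  0ℚ , r , u , subst (_< 1ℚ) (sym (*-zeroˡ r)) (positive⁻¹ 1ℚ)
recip x 0<x .U-inhab with r , 0<r , l ← L-open x 0<x with s , _ , sr≡1 ← inverse 0<r =
  s + 1ℚ , r , 0<r , l , subst (_< (s + 1ℚ) * r) sr≡1 (*-monoˡ 0<r (p<p+1 s))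
recip x 0<x .L-closed p<q (r , u , qr<1) = r , u , <-trans (*-monoˡ (L<U x 0<x u) p<q) qr<1
recip x 0<x .U-closed p<q (r , 0<r , l , 1<pr) = r , 0<r , l , <-trans 1<pr (*-monoˡ 0<r p<q)
recip x 0<x .L-open {p} (r , u , pr<1) with s , pr<s , s<1 ← <-dense pr<1
  with q , qr≡s ← divide s (L<U x 0<x u) =
  q , *-cancel (L<U x 0<x u) (subst (p * r <_) (sym qr≡s) pr<s) ,
  r , u , subst (_< 1ℚ) (sym qr≡s) s<1
recip x 0<x .U-open {q} (r , 0<r , l , 1<qr) with s , 1<s , s<qr ← <-dense 1<qr
  with p , pr≡s ← divide s 0<r =
  p , *-cancel 0<r (subst (_< q * r) (sym pr≡s) s<qr) ,
  r , 0<r , l , subst (1ℚ <_) (sym pr≡s) 1<s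
recip x 0<x .disjoint {p} (r , u , pr<1) (s , 0<s , l , 1<ps) =
  <-asym (<-trans 1<ps ps<pr) pr<1
  where
  0<p : 0ℚ < p
  0<p = *-cancel 0<s (subst (_< p * s) (sym (*-zeroˡ s)) (<-trans (positive⁻¹ 1ℚ) 1<ps))
  ps<pr : p * s < p * r
  ps<pr = subst₂ _<_ (*-comm s p) (*-comm r p) (*-monoˡ 0<p (L<U x l u))
recip x 0<x .located {p} {q} p<q with 0ℚ <? p
... | no 0≮p with r , u ← U-inhab x =
  inj₁ (r , u , ≤-<-trans (subst (p * r ≤_) (*-zeroˡ r)
    (*-monoʳ-≤-nonNeg r {{nonNegative (<⇒≤ (L<U x 0<x u))}} (≮⇒≥ 0≮p))) (positive⁻¹ 1ℚ))
... | yes 0<p with inverse 0<p | inverse (<-trans 0<p p<q)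
... | p⁻¹ , 0<p⁻¹ , p⁻¹p≡1 | q⁻¹ , 0<q⁻¹ , q⁻¹q≡1 with located x q⁻¹<p⁻¹
  where
  q⁻¹<p⁻¹ : q⁻¹ < p⁻¹
  q⁻¹<p⁻¹ = *-cancel 0<p (subst (q⁻¹ * p <_) (trans q⁻¹q≡1 (sym p⁻¹p≡1))
    (subst₂ _<_ (*-comm p q⁻¹) (*-comm q q⁻¹) (*-monoˡ 0<q⁻¹ p<q)))
... | inj₁ l with r , q⁻¹<r , l′ ← L-open x l =
  inj₂ (r , <-trans 0<q⁻¹ q⁻¹<r , l′ ,
    subst₂ _<_ q⁻¹q≡1 (*-comm r q) (*-monoˡ (<-trans 0<p p<q) q⁻¹<r))
... | inj₂ u with r , r<p⁻¹ , u′ ← U-open x u =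
  inj₁ (r , u′ , subst₂ _<_ (*-comm r p) p⁻¹p≡1 (*-monoˡ 0<p r<p⁻¹))

private

  -- The step q ↦ (q t + c) / (q + t), where t = c + 1, moves a nonnegative q
  -- towards √ c without passing it, since
  -- c (q + t)² - (q t + c)² = (c - q²) (t² - c).
  module Approach {q c : ℚ} (0≤q : 0ℚ ≤ q) (0<c : 0ℚ < c) where

    t s : ℚ
    t = c + 1ℚ
    s = q + t

    0<t : 0ℚ < t
    0<t = <-trans 0<c (p<p+1 c)

    0<s : 0ℚ < s
    0<s = +-mono-≤-< 0≤q 0<t

    step : ℚ
    step = divide (q * t + c) 0<s .Data.Product.proj₁

    step-s : step * s ≡ q * t + c
    step-s = divide (q * t + c) 0<s .Data.Product.proj₂

    0<t²-c : 0ℚ < t * t - c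
    0<t²-c = subst (0ℚ <_)
      (solve 1 (λ c → (c :* c :+ c) :+ con 1ℚ := (c :+ con 1ℚ) :* (c :+ con 1ℚ) :- c) refl c)
      (+-mono-< (+-mono-< (*-pos 0<c 0<c) 0<c) (positive⁻¹ 1ℚ))

    step²-s² : (step * step) * (s * s) ≡ (q * t + c) * (q * t + c)
    step²-s² = trans (solve 2 (λ p s → (p :* p) :* (s :* s) := (p :* s) :* (p :* s)) refl step s)
      (cong (λ z → z * z) step-s)

    module Below (q²<c : q * q < c) where

      q<step : q < step
      q<step = *-cancel 0<s (subst (q * s <_) (sym step-s) (shift q²<c
        (solve 3 (λ q c t → c :- q :* q := (q :* t :+ c) :- q :* (q :+ t)) refl q c t)))

      step²<c : step * step < c
      step²<c = *-cancel (*-pos 0<s 0<s) (subst (_< c * (s * s)) (sym step²-s²)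
        (shift (*-pos (0<q-p q²<c) 0<t²-c) (solve 3 (λ q c t →
          (c :- q :* q) :* (t :* t :- c) :- con 0ℚ :=
          c :* ((q :+ t) :* (q :+ t)) :- (q :* t :+ c) :* (q :* t :+ c)) refl q c t)))

    module Above (c<q² : c < q * q) where

      step<q : step < q
      step<q = *-cancel 0<s (subst (_< q * s) (sym step-s) (shift c<q²
        (solve 3 (λ q c t → q :* q :- c := q :* (q :+ t) :- (q :* t :+ c)) refl q c t)))

      c<step² : c < step * step
      c<step² = *-cancel (*-pos 0<s 0<s) (subst (c * (s * s) <_) (sym step²-s²)
        (shift (*-pos (0<q-p c<q²) 0<t²-c) (solve 3 (λ q c t →
          (q :* q :- c) :* (t :* t :- c) :- con 0ℚ :=
          (q :* t :+ c) :* (q :* t :+ c) :- c :* ((q :+ t) :* (q :+ t))) refl q c t)))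

      0<step : 0ℚ < step
      0<step = *-cancel 0<s (subst₂ _<_ (sym (*-zeroˡ s)) (sym step-s)
        (+-mono-≤-< (subst (_≤ q * t) (*-zeroˡ t)
          (*-monoʳ-≤-nonNeg t {{nonNegative (<⇒≤ 0<t)}} 0≤q)) 0<c))

-- The nonnegative square root of x ≥ 0 (for x < 0 this is 0).
√ : ℝ → ℝ
√ x .L q = q < 0ℚ ⊎ L x (q * q)
√ x .U q = 0ℚ < q × U x (q * q)
√ x .L-inhab = 0ℚ - 1ℚ , inj₁ (p-1<p 0ℚ)
√ x .U-inhab with u , h ← U-inhab x with 0ℚ <? u
... | yes 0<u = u + 1ℚ , <-trans 0<u (p<p+1 u) ,
      U-closed x (shift (+-mono-< (+-mono-< (*-pos 0<u 0<u) 0<u) (positive⁻¹ 1ℚ))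
        (solve 1 (λ u → (u :* u :+ u :+ con 1ℚ) :- con 0ℚ :=
          (u :+ con 1ℚ) :* (u :+ con 1ℚ) :- u) refl u)) h
... | no  0≮u = 1ℚ , positive⁻¹ 1ℚ , U-closed x (≤-<-trans (≮⇒≥ 0≮u) (positive⁻¹ 1ℚ)) h
√ x .L-closed p<q (inj₁ q<0) = inj₁ (<-trans p<q q<0)
√ x .L-closed {p} p<q (inj₂ l) with p <? 0ℚ
... | yes p<0 = inj₁ p<0
... | no  p≮0 = inj₂ (L-closed x (square-mono (≮⇒≥ p≮0) p<q) l)
√ x .U-closed p<q (0<p , u) = <-trans 0<p p<q , U-closed x (square-mono (<⇒≤ 0<p) p<q) u
√ x .L-open {p} (inj₁ p<0) with q , p<q , q<0 ← <-dense p<0 = q , p<q , inj₁ q<0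
√ x .L-open {p} (inj₂ l) with p <? 0ℚ
... | yes p<0 with q , p<q , q<0 ← <-dense p<0 = q , p<q , inj₁ q<0
... | no  p≮0 with c , p²<c , l′ ← L-open x l =
  step , q<step , inj₂ (L-closed x step²<c l′)
  where
  0≤p² : 0ℚ ≤ p * p
  0≤p² = subst (_≤ p * p) (*-zeroˡ p) (*-monoʳ-≤-nonNeg p {{nonNegative (≮⇒≥ p≮0)}} (≮⇒≥ p≮0))
  open Approach (≮⇒≥ p≮0) (≤-<-trans 0≤p² p²<c)
  open Below p²<c
√ x .U-open {q} (0<q , u) = go (U-open x u)
  where
  from : ∀ {c} → 0ℚ < c → c < q * q → U x c → ∃[ p ] (p < q × √ x .U p)
  from 0<c c<q² u′ = step , step<q , 0<step , U-closed x c<step² u′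
    where
    open Approach (<⇒≤ 0<q) 0<c
    open Above c<q²
  go : ∃[ c ] (c < q * q × U x c) → ∃[ p ] (p < q × √ x .U p)
  go (c , c<q² , u′) with 0ℚ <? c
  ... | yes 0<c = from 0<c c<q² u′
  ... | no  0≮c with d , 0<d , d<q² ← <-dense (*-pos 0<q 0<q) =
    from 0<d d<q² (U-closed x (≤-<-trans (≮⇒≥ 0≮c) 0<d) u′)
√ x .disjoint (inj₁ p<0) (0<p , _) = <-asym p<0 0<p
√ x .disjoint (inj₂ l)   (_   , u) = disjoint x l u
√ x .located {p} {q} p<q with p <? 0ℚ
... | yes p<0 = inj₁ (inj₁ p<0)
... | no  p≮0 with located x (square-mono (≮⇒≥ p≮0) p<q)
...   | inj₁ l = inj₁ (inj₂ l)
...   | inj₂ u = inj₂ (≤-<-trans (≮⇒≥ p≮0) p<q , u)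

√-positive : ∀ a → .{{Positive a}} → L (√ (a ᴿ)) 0ℚ
√-positive a = inj₂ (positive⁻¹ a)

-- Meant for 0 < a ≤ 1/2; the second formula is simply kept for larger a.
φ : (a : ℚ) → .{{Positive a}} → ℝ
φ a with a ≤? + 1 / 4
... | yes _ = recip (√ (a ᴿ)) (√-positive a) -ᴿ 1ℚ ᴿ
... | no  _ = ((1/ (+ 4 / 1 * a)) {{>-nonZero (*-pos (positive⁻¹ (+ 4 / 1)) (positive⁻¹ a))}}) ᴿ

{-# OPTIONS --safe #-}

-- Let F_k be the sum, over |S| = k, of (Σ_{x ∈ A} χ_S(x))². Since n - 2 d(x, y) is the
-- kernel Σ_i x_i y_i, F_1 = |A|² (n - 2 D(A)), while F_0 = |A|² and Σ_k F_k = 2ⁿ |A|.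
-- For 0 ≤ v ≤ 1 the noise kernel Σ_S (-v)^|S| χ_S(x) χ_S(y) = Π_i (1 - v x_i y_i) is
-- nonnegative pointwise, so Σ_k (-v)ᵏ F_k ≥ 0. As (-v)ᵏ ≤ v² for k ≥ 2, this gives
--   (v² + v) (n - 2 D(A)) ≤ v² / a + 1 - v².
-- With v = 1 this is the bound 1 / (4 a); with v = 1 / (s - 1) and s > 1 / √a ≥ 2 rational
-- it gives n / 2 - D(A) < s - 1, so no square root has to be evaluated.
module Submission where

open import Defs
open import Data.Integer as ℤ using (+_)
import Data.Integer.Properties as ℤ
open import Data.Bool using (T?)
open import Data.List using (List; []; _∷_; map; foldr; length; cartesianProduct; _++_)
open import Data.List.Relation.Unary.All as All using (All; []; _∷_)
open import Data.List.Relation.Unary.AllPairs using ([]; _∷_)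
open import Data.List.Relation.Unary.Unique.Propositional using (Unique)
open import Data.List.Relation.Unary.Unique.Propositional.Properties using (filter⁺; cartesianProductWith⁺)
open import Data.Nat as ℕ using (ℕ; zero; suc; _≤_; _∸_; _^_)
import Data.Nat.Properties as ℕ
open import Data.Nat.ListAction using (sum)
open import Data.Product using (_×_; _,_; uncurry)
open import Data.Rational
  using (ℚ; _/_; 0ℚ; 1ℚ; _+_; _-_; -_; _*_; 1/_; _<_; Positive; positive; nonNegative; toℚᵘ; >-nonZero)
  renaming (_≤_ to _≤ℚ_)
open import Data.Rational.Properties
open import Data.Rational.Solver using (module +-*-Solver)
import Data.Rational.Unnormalised as ℚᵘ
import Data.Rational.Unnormalised.Properties as ℚᵘ
open import Data.Sign using (Sign)
open import Data.Sum using (inj₁; inj₂)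
open import Data.Vec using (head; tail) renaming ([] to []ᵛ; _∷_ to _∷ᵛ_)
open import Data.Vec.Properties using (∷-injective)
open import Function using (_∘_)
open import Relation.Binary.PropositionalEquality
  using (_≡_; _≢_; refl; sym; trans; cong; cong₂; subst; subst₂; module ≡-Reasoning)
open import Relation.Nullary using (yes; no)
open import Relation.Nullary.Negation using (contradiction)

open +-*-Solver using (solve; _:+_; _:-_; _:*_; :-_; con; _:=_)
open ℝ

-- Order lemmas for the rationals.

-- Turns an inequality into a ring identity for the solver: `e` is a combination whose sign is
-- already known. `0<⇒<` is the strict form.
0≤⇒≤ : ∀ {e p q} → 0ℚ ≤ℚ e → e ≡ q - p → p ≤ℚ q
0≤⇒≤ {p = p} {q} 0≤e e≡q-p = subst₂ _≤ℚ_ (+-identityˡ p)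
  (solve 2 (λ p q → (q :- p) :+ p := q) refl p q)
  (+-monoˡ-≤ p (subst (0ℚ ≤ℚ_) e≡q-p 0≤e))

0<⇒< : ∀ {e p q} → 0ℚ < e → e ≡ q - p → p < q
0<⇒< {p = p} {q} 0<e e≡q-p = subst₂ _<_ (+-identityˡ p)
  (solve 2 (λ p q → (q :- p) :+ p := q) refl p q)
  (+-monoˡ-< p (subst (0ℚ <_) e≡q-p 0<e))

p≤q⇒0≤q-p : ∀ {p q} → p ≤ℚ q → 0ℚ ≤ℚ q - p
p≤q⇒0≤q-p {p} {q} p≤q = subst (_≤ℚ q - p) (+-inverseʳ p) (+-monoˡ-≤ (- p) p≤q)

p<q⇒0<q-p : ∀ {p q} → p < q → 0ℚ < q - p
p<q⇒0<q-p {p} {q} p<q = subst (_< q - p) (+-inverseʳ p) (+-monoˡ-< (- p) p<q)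

+-nonNeg : ∀ {p q} → 0ℚ ≤ℚ p → 0ℚ ≤ℚ q → 0ℚ ≤ℚ p + q
+-nonNeg = +-mono-≤

*-nonNeg : ∀ {p q} → 0ℚ ≤ℚ p → 0ℚ ≤ℚ q → 0ℚ ≤ℚ p * q
*-nonNeg {p} {q} 0≤p 0≤q =
  nonNegative⁻¹ (p * q) {{nonNeg*nonNeg⇒nonNeg p {{nonNegative 0≤p}} q {{nonNegative 0≤q}}}}

*-pos : ∀ {p q} → 0ℚ < p → 0ℚ < q → 0ℚ < p * q
*-pos {p} {q} 0<p 0<q = positive⁻¹ (p * q) {{pos*pos⇒pos p {{positive 0<p}} q {{positive 0<q}}}}

square-nonNeg : ∀ p → 0ℚ ≤ℚ p * p
square-nonNeg p with 0ℚ ≤? p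
... | yes 0≤p = *-nonNeg 0≤p 0≤p
... | no  0≰p = subst (0ℚ ≤ℚ_) (solve 1 (λ p → :- p :* :- p := p :* p) refl p) (*-nonNeg 0≤-p 0≤-p)
  where
  0≤-p : 0ℚ ≤ℚ - p
  0≤-p = neg-antimono-≤ (<⇒≤ (≰⇒> 0≰p))

*-cancelʳ-≤ : ∀ {p q r} → 0ℚ < r → p * r ≤ℚ q * r → p ≤ℚ q
*-cancelʳ-≤ {r = r} 0<r = *-cancelʳ-≤-pos r {{positive 0<r}}

*-cancelʳ-< : ∀ {p q r} → 0ℚ < r → p * r < q * r → p < q
*-cancelʳ-< {r = r} 0<r = *-cancelʳ-<-nonNeg r {{nonNegative (<⇒≤ 0<r)}}

*-monoʳ-< : ∀ {p q r} → 0ℚ < r → p < q → p * r < q * r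
*-monoʳ-< {r = r} 0<r = *-monoˡ-<-pos r {{positive 0<r}}

-- Naturals inside the rationals.

ι : ℕ → ℚ
ι n = + n / 1

toℚᵘ-/ : ∀ i n .{{_ : ℕ.NonZero n}} → toℚᵘ (i / n) ℚᵘ.≃ i ℚᵘ./ n
toℚᵘ-/ i (suc n) = toℚᵘ-fromℚᵘ (ℚᵘ.mkℚᵘ i n)

ι-+ : ∀ m n → ι (m ℕ.+ n) ≡ ι m + ι n
ι-+ m n = toℚᵘ-injective (ℚᵘ.≃-trans (toℚᵘ-/ (+ (m ℕ.+ n)) 1) (ℚᵘ.≃-trans
  (ℚᵘ.*≡* (cong (ℤ._* + 1) (cong₂ ℤ._+_ (sym (ℤ.*-identityʳ (+ m))) (sym (ℤ.*-identityʳ (+ n))))))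
  (ℚᵘ.≃-sym (ℚᵘ.≃-trans (toℚᵘ-homo-+ (ι m) (ι n)) (ℚᵘ.+-cong (toℚᵘ-/ (+ m) 1) (toℚᵘ-/ (+ n) 1))))))

ι-suc : ∀ n → ι (suc n) ≡ 1ℚ + ι n
ι-suc = ι-+ 1

ι-* : ∀ m n → ι (m ℕ.* n) ≡ ι m * ι n
ι-* m n = toℚᵘ-injective (ℚᵘ.≃-trans (toℚᵘ-/ (+ (m ℕ.* n)) 1) (ℚᵘ.≃-trans
  (ℚᵘ.*≡* (cong (ℤ._* + 1) (ℤ.pos-* m n)))
  (ℚᵘ.≃-sym (ℚᵘ.≃-trans (toℚᵘ-homo-* (ι m) (ι n)) (ℚᵘ.*-cong (toℚᵘ-/ (+ m) 1) (toℚᵘ-/ (+ n) 1))))))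

-- Clears the denominators of the density, of `D A` and of n / 2.
/-*-ι : ∀ m n .{{_ : ℕ.NonZero n}} → + m / n * ι n ≡ ι m
/-*-ι m n@(suc _) = toℚᵘ-injective (ℚᵘ.≃-trans (toℚᵘ-homo-* (+ m / n) (ι n))
  (ℚᵘ.≃-trans (ℚᵘ.*-cong (toℚᵘ-/ (+ m) n) (toℚᵘ-/ (+ n) 1))
  (ℚᵘ.≃-trans (ℚᵘ.*≡* (ℤ.*-assoc (+ m) (+ n) (+ 1))) (ℚᵘ.≃-sym (toℚᵘ-/ (+ m) 1)))))

ι-pos : ∀ n .{{_ : ℕ.NonZero n}} → 0ℚ < ι n
ι-pos n = positive⁻¹ (ι n) {{normalize-pos n 1}}

-- Finite sums and double sums.

∑ : ∀ {I : Set} → List I → (I → ℚ) → ℚ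
∑ xs f = foldr (λ x s → f x + s) 0ℚ xs

module _ {I : Set} where

  ∑-cong : ∀ xs {f g : I → ℚ} → (∀ x → f x ≡ g x) → ∑ xs f ≡ ∑ xs g
  ∑-cong []       f≡g = refl
  ∑-cong (x ∷ xs) f≡g = cong₂ _+_ (f≡g x) (∑-cong xs f≡g)

  ∑-mono : ∀ xs {f g : I → ℚ} → (∀ x → f x ≤ℚ g x) → ∑ xs f ≤ℚ ∑ xs g
  ∑-mono []       f≤g = ≤-refl
  ∑-mono (x ∷ xs) f≤g = +-mono-≤ (f≤g x) (∑-mono xs f≤g)

  ∑-+ : ∀ xs (f g : I → ℚ) → ∑ xs (λ x → f x + g x) ≡ ∑ xs f + ∑ xs g
  ∑-+ []       f g = refl
  ∑-+ (x ∷ xs) f g = trans (cong (_+_ (f x + g x)) (∑-+ xs f g))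
    (solve 4 (λ a b c d → (a :+ b) :+ (c :+ d) := (a :+ c) :+ (b :+ d)) refl
      (f x) (g x) (∑ xs f) (∑ xs g))

  ∑-*ˡ : ∀ xs r (f : I → ℚ) → ∑ xs (λ x → r * f x) ≡ r * ∑ xs f
  ∑-*ˡ []       r f = sym (*-zeroʳ r)
  ∑-*ˡ (x ∷ xs) r f = trans (cong (_+_ (r * f x)) (∑-*ˡ xs r f)) (sym (*-distribˡ-+ r (f x) (∑ xs f)))

  ∑-0 : ∀ {xs} {f : I → ℚ} → All (λ x → f x ≡ 0ℚ) xs → ∑ xs f ≡ 0ℚ
  ∑-0 []         = refl
  ∑-0 (fx≡0 ∷ h) = cong₂ _+_ fx≡0 (∑-0 h)

  ∑-const : ∀ (xs : List I) r → ∑ xs (λ _ → r) ≡ r * ι (length xs)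
  ∑-const []       r = sym (*-zeroʳ r)
  ∑-const (x ∷ xs) r = trans (cong (_+_ r) (∑-const xs r)) (trans
    (solve 2 (λ r l → r :+ r :* l := r :* (con 1ℚ :+ l)) refl r (ι (length xs)))
    (cong (_*_ r) (sym (ι-suc (length xs)))))

  ∑-ι : ∀ (xs : List I) f → ∑ xs (ι ∘ f) ≡ ι (sum (map f xs))
  ∑-ι []       f = refl
  ∑-ι (x ∷ xs) f = trans (cong (_+_ (ι (f x))) (∑-ι xs f)) (sym (ι-+ (f x) (sum (map f xs))))

  ∑∑-cong : ∀ xs {f g : I → I → ℚ} → (∀ x y → f x y ≡ g x y) →
            ∑ xs (λ x → ∑ xs (f x)) ≡ ∑ xs (λ x → ∑ xs (g x))
  ∑∑-cong xs f≡g = ∑-cong xs (λ x → ∑-cong xs (f≡g x))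

  ∑∑-+ : ∀ xs (f g : I → I → ℚ) → ∑ xs (λ x → ∑ xs (λ y → f x y + g x y)) ≡
         ∑ xs (λ x → ∑ xs (f x)) + ∑ xs (λ x → ∑ xs (g x))
  ∑∑-+ xs f g = trans (∑-cong xs (λ x → ∑-+ xs (f x) (g x)))
    (∑-+ xs (λ x → ∑ xs (f x)) (λ x → ∑ xs (g x)))

  ∑∑-*ˡ : ∀ xs r (f : I → I → ℚ) → ∑ xs (λ x → ∑ xs (λ y → r * f x y)) ≡ r * ∑ xs (λ x → ∑ xs (f x))
  ∑∑-*ˡ xs r f = trans (∑-cong xs (λ x → ∑-*ˡ xs r (f x))) (∑-*ˡ xs r (λ x → ∑ xs (f x)))

  ∑∑-const : ∀ (xs : List I) r → ∑ xs (λ _ → ∑ xs (λ _ → r)) ≡ r * (ι (length xs) * ι (length xs))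
  ∑∑-const xs r = trans (∑-cong xs (λ _ → ∑-const xs r)) (trans (∑-const xs (r * ι (length xs)))
    (*-assoc r (ι (length xs)) (ι (length xs))))

  -- Splitting off the first row and the first column leaves only `f x x` from them, because `x`
  -- does not recur in `xs`. Applied to `K const1`, it gives the total 2ⁿ |A|.
  ∑∑-diagonal : ∀ {xs} {f : I → I → ℚ} {r} → (∀ x → f x x ≡ r) → (∀ x y → x ≢ y → f x y ≡ 0ℚ) →
                Unique xs → ∑ xs (λ x → ∑ xs (f x)) ≡ r * ι (length xs)
  ∑∑-diagonal {[]} {r = r} diag off [] = sym (*-zeroʳ r)
  ∑∑-diagonal {x ∷ xs} {f} {r} diag off (x∉xs ∷ uniq) = begin
    (f x x + ∑ xs (f x)) + ∑ xs (λ y → f y x + ∑ xs (f y))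
      ≡⟨ cong₂ _+_ (cong₂ _+_ (diag x) (∑-0 (All.map (off x _) x∉xs)))
           (trans (∑-+ xs (λ y → f y x) (λ y → ∑ xs (f y)))
             (cong₂ _+_ (∑-0 (All.map (λ x≢y → off _ x (x≢y ∘ sym)) x∉xs)) (∑∑-diagonal diag off uniq))) ⟩
    (r + 0ℚ) + (0ℚ + r * ι (length xs))
      ≡⟨ solve 2 (λ r l → (r :+ con 0ℚ) :+ (con 0ℚ :+ r :* l) := r :* (con 1ℚ :+ l)) refl r (ι (length xs)) ⟩
    r * (1ℚ + ι (length xs))
      ≡⟨ cong (_*_ r) (sym (ι-suc (length xs))) ⟩
    r * ι (length (x ∷ xs)) ∎
    where open ≡-Reasoning

∑-++ : ∀ {I : Set} (xs ys : List I) f → ∑ (xs ++ ys) f ≡ ∑ xs f + ∑ ys f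
∑-++ []       ys f = sym (+-identityˡ (∑ ys f))
∑-++ (x ∷ xs) ys f = trans (cong (_+_ (f x)) (∑-++ xs ys f)) (sym (+-assoc (f x) (∑ xs f) (∑ ys f)))

∑-map : ∀ {I J : Set} (h : I → J) xs f → ∑ (map h xs) f ≡ ∑ xs (f ∘ h)
∑-map h []       f = refl
∑-map h (x ∷ xs) f = cong (_+_ (f (h x))) (∑-map h xs f)

∑-cartesianProduct : ∀ {I J : Set} (xs : List I) (ys : List J) f →
  ∑ (cartesianProduct xs ys) f ≡ ∑ xs (λ x → ∑ ys (λ y → f (x , y)))
∑-cartesianProduct []       ys f = refl
∑-cartesianProduct (x ∷ xs) ys f = trans (∑-++ (map (x ,_) ys) (cartesianProduct xs ys) f)
  (cong₂ _+_ (∑-map (x ,_) ys f) (∑-cartesianProduct xs ys f))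

-- Kernels on the cube built from characters weighted by level.

sgn : Sign → ℚ
sgn Sign.+ = 1ℚ
sgn Sign.- = - 1ℚ

-- K c x y is the sum of c |S| χ_S(x) χ_S(y) over all S ⊆ {1, …, n}.
K : ∀ {n} → (ℕ → ℚ) → Cube n → Cube n → ℚ
K {zero}  c x y = c 0
K {suc n} c x y = K c (tail x) (tail y) + sgn (head x) * sgn (head y) * K (c ∘ suc) (tail x) (tail y)

-- Together with `K-*ˡ` this is linearity in the coefficients, by which the kernel of `coefficient`
-- splits into four explicit ones.
K-+ : ∀ {n} c d (x y : Cube n) → K (λ k → c k + d k) x y ≡ K c x y + K d x y
K-+ c d []ᵛ      []ᵛ      = refl
K-+ c d (s ∷ᵛ x) (t ∷ᵛ y) = trans
  (cong₂ (λ a b → a + sgn s * sgn t * b) (K-+ c d x y) (K-+ (c ∘ suc) (d ∘ suc) x y))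
  (solve 5 (λ a b e c d → (a :+ b) :+ e :* (c :+ d) := (a :+ e :* c) :+ (b :+ e :* d)) refl
    (K c x y) (K d x y) (sgn s * sgn t) (K (c ∘ suc) x y) (K (d ∘ suc) x y))

K-*ˡ : ∀ {n} r c (x y : Cube n) → K (λ k → r * c k) x y ≡ r * K c x y
K-*ˡ r c []ᵛ      []ᵛ      = refl
K-*ˡ r c (s ∷ᵛ x) (t ∷ᵛ y) = trans
  (cong₂ (λ a b → a + sgn s * sgn t * b) (K-*ˡ r c x y) (K-*ˡ r (c ∘ suc) x y))
  (solve 4 (λ r a e b → r :* a :+ e :* (r :* b) := r :* (a :+ e :* b)) refl
    r (K c x y) (sgn s * sgn t) (K (c ∘ suc) x y))

-- Characters χ_S with 1 ∈ S are handled by multiplying the first coordinate into the weights q.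
K-positive-semidefinite : ∀ {I : Set} n c → (∀ k → 0ℚ ≤ℚ c k) → (xs : List I) (p : I → Cube n) (q : I → ℚ) →
  0ℚ ≤ℚ ∑ xs (λ i → ∑ xs (λ j → q i * q j * K c (p i) (p j)))
K-positive-semidefinite zero c 0≤c xs p q = subst (0ℚ ≤ℚ_) (sym eq) (*-nonNeg (0≤c 0) (square-nonNeg (∑ xs q)))
  where
  open ≡-Reasoning
  eq : ∑ xs (λ i → ∑ xs (λ j → q i * q j * c 0)) ≡ c 0 * (∑ xs q * ∑ xs q)
  eq = begin
    ∑ xs (λ i → ∑ xs (λ j → q i * q j * c 0))
      ≡⟨ ∑∑-cong xs (λ i j → *-comm (q i * q j) (c 0)) ⟩
    ∑ xs (λ i → ∑ xs (λ j → c 0 * (q i * q j)))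
      ≡⟨ ∑∑-*ˡ xs (c 0) (λ i j → q i * q j) ⟩
    c 0 * ∑ xs (λ i → ∑ xs (λ j → q i * q j))
      ≡⟨ cong (_*_ (c 0)) (∑-cong xs (λ i → trans (∑-*ˡ xs (q i) q) (*-comm (q i) (∑ xs q)))) ⟩
    c 0 * ∑ xs (λ i → ∑ xs q * q i)
      ≡⟨ cong (_*_ (c 0)) (∑-*ˡ xs (∑ xs q) q) ⟩
    c 0 * (∑ xs q * ∑ xs q) ∎
K-positive-semidefinite {I} (suc n) c 0≤c xs p q = subst (0ℚ ≤ℚ_) (sym eq)
  (+-nonNeg (K-positive-semidefinite n c 0≤c xs (tail ∘ p) q)
            (K-positive-semidefinite n (c ∘ suc) (0≤c ∘ suc) xs (tail ∘ p) q′))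
  where
  q′ : I → ℚ
  q′ i = sgn (head (p i)) * q i
  a b : I → I → ℚ
  a i j = K c (tail (p i)) (tail (p j))
  b i j = K (c ∘ suc) (tail (p i)) (tail (p j))
  eq : ∑ xs (λ i → ∑ xs (λ j → q i * q j * K c (p i) (p j))) ≡
       ∑ xs (λ i → ∑ xs (λ j → q i * q j * a i j)) + ∑ xs (λ i → ∑ xs (λ j → q′ i * q′ j * b i j))
  eq = trans (∑∑-cong xs (λ i j →
      solve 6 (λ u v s t a b → u :* v :* (a :+ s :* t :* b) := u :* v :* a :+ (s :* u) :* (t :* v) :* b) refl
        (q i) (q j) (sgn (head (p i))) (sgn (head (p j))) (a i j) (b i j)))
    (∑∑-+ xs (λ i j → q i * q j * a i j) (λ i j → q′ i * q′ j * b i j))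

-- Explicit kernels for particular coefficient sequences.

-- These select all characters, the empty one, and the singletons. Definitionally `δ₁ ∘ suc` is `δ₀`
-- and `δ₀ ∘ suc` vanishes, so the recursion of `K` leads from `K-δ₁` to `K-δ₀` to `K-0`.
const1 δ₀ δ₁ : ℕ → ℚ
const1 _ = 1ℚ
δ₀ zero    = 1ℚ
δ₀ (suc k) = 0ℚ
δ₁ zero    = 0ℚ
δ₁ (suc k) = δ₀ k

power : ℚ → ℕ → ℚ
power r zero    = 1ℚ
power r (suc k) = r * power r k

K-0 : ∀ {n} (x y : Cube n) → K (λ _ → 0ℚ) x y ≡ 0ℚ
K-0 []ᵛ      []ᵛ      = refl
K-0 (s ∷ᵛ x) (t ∷ᵛ y) = trans (cong₂ (λ a b → a + sgn s * sgn t * b) (K-0 x y) (K-0 x y))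
  (solve 1 (λ e → con 0ℚ :+ e :* con 0ℚ := con 0ℚ) refl (sgn s * sgn t))

K-δ₀ : ∀ {n} (x y : Cube n) → K δ₀ x y ≡ 1ℚ
K-δ₀ []ᵛ      []ᵛ      = refl
K-δ₀ (s ∷ᵛ x) (t ∷ᵛ y) = trans (cong₂ (λ a b → a + sgn s * sgn t * b) (K-δ₀ x y) (K-0 x y))
  (solve 1 (λ e → con 1ℚ :+ e :* con 0ℚ := con 1ℚ) refl (sgn s * sgn t))

-- This is Σ_i x_i y_i: an agreeing coordinate contributes 1 and a differing one -1 = 1 - 2.
K-δ₁ : ∀ {n} (x y : Cube n) → K δ₁ x y ≡ ι n + - ι 2 * ι (dᴴ x y)
K-δ₁ []ᵛ []ᵛ = refl
K-δ₁ {suc n} (s ∷ᵛ x) (t ∷ᵛ y) =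
  trans (cong₂ (λ a b → a + sgn s * sgn t * b) (K-δ₁ x y) (K-δ₀ x y)) (go s t)
  where
  N d : ℚ
  N = ι n
  d = ι (dᴴ x y)
  agree : N + - ι 2 * d + 1ℚ ≡ ι (suc n) + - ι 2 * d
  agree = trans (solve 2 (λ N d → N :+ con (- ι 2) :* d :+ con 1ℚ := (con 1ℚ :+ N) :+ con (- ι 2) :* d) refl N d)
    (cong (_+ - ι 2 * d) (sym (ι-suc n)))
  differ : N + - ι 2 * d + - 1ℚ ≡ ι (suc n) + - ι 2 * ι (suc (dᴴ x y))
  differ = trans (solve 2 (λ N d → N :+ con (- ι 2) :* d :+ con (- 1ℚ) :=
      (con 1ℚ :+ N) :+ con (- ι 2) :* (con 1ℚ :+ d)) refl N d)
    (sym (cong₂ (λ a b → a + - ι 2 * b) (ι-suc n) (ι-suc (dᴴ x y))))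
  go : ∀ s t → N + - ι 2 * d + sgn s * sgn t * 1ℚ ≡ ι (suc n) + - ι 2 * ι (dᴴ (s ∷ᵛ x) (t ∷ᵛ y))
  go Sign.+ Sign.+ = agree
  go Sign.- Sign.- = agree
  go Sign.+ Sign.- = differ
  go Sign.- Sign.+ = differ

-- The kernel of `const1` is the product of the factors 1 + x_i y_i, and on the diagonal each factor
-- is 2.
K-const1-diagonal : ∀ {n} (x : Cube n) → K const1 x x ≡ ι (2 ^ n)
K-const1-diagonal []ᵛ = refl
K-const1-diagonal {suc n} (s ∷ᵛ x) = trans (cong (λ a → a + sgn s * sgn s * a) (K-const1-diagonal x))
  (trans (cong (λ e → ι (2 ^ n) + e * ι (2 ^ n)) (s²≡1 s))
  (trans (solve 1 (λ a → a :+ con 1ℚ :* a := con (ι 2) :* a) refl (ι (2 ^ n))) (sym (ι-* 2 (2 ^ n)))))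
  where
  s²≡1 : ∀ s → sgn s * sgn s ≡ 1ℚ
  s²≡1 Sign.+ = refl
  s²≡1 Sign.- = refl

-- Some coordinate differs, and its factor 1 + x_i y_i is 0.
K-const1-off-diagonal : ∀ {n} (x y : Cube n) → x ≢ y → K const1 x y ≡ 0ℚ
K-const1-off-diagonal []ᵛ []ᵛ x≢y = contradiction refl x≢y
K-const1-off-diagonal (s ∷ᵛ x) (t ∷ᵛ y) sx≢ty = go s t sx≢ty
  where
  a : ℚ
  a = K const1 x y
  agree : x ≢ y → a + 1ℚ * a ≡ 0ℚ
  agree x≢y = cong (λ a → a + 1ℚ * a) (K-const1-off-diagonal x y x≢y)
  differ : a + - 1ℚ * a ≡ 0ℚ
  differ = solve 1 (λ a → a :+ con (- 1ℚ) :* a := con 0ℚ) refl a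
  go : ∀ s t → s ∷ᵛ x ≢ t ∷ᵛ y → a + sgn s * sgn t * a ≡ 0ℚ
  go Sign.+ Sign.+ h = agree (h ∘ cong (Sign.+ ∷ᵛ_))
  go Sign.- Sign.- h = agree (h ∘ cong (Sign.- ∷ᵛ_))
  go Sign.+ Sign.- h = differ
  go Sign.- Sign.+ h = differ

-- The distance inequality for a fixed noise parameter v.

elements-unique : ∀ {n} (A : Code n) → Unique (elements A)
elements-unique {n} A = filter⁺ (T? ∘ A) (cube-unique n)
  where
  cube-unique : ∀ n → Unique (cube n)
  cube-unique zero    = [] ∷ []
  cube-unique (suc n) = cartesianProductWith⁺ _∷ᵛ_ ∷-injective
    (((λ ()) ∷ []) ∷ ([] ∷ [])) (cube-unique n)

module _ {v : ℚ} (0≤v : 0ℚ ≤ℚ v) (v≤1 : v ≤ℚ 1ℚ) where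

  0≤1-v : 0ℚ ≤ℚ 1ℚ - v
  0≤1-v = p≤q⇒0≤q-p v≤1

  -- K (power (- v)) x y is the product of the factors 1 - v xᵢ yᵢ.
  K-power-nonNeg : ∀ {n} (x y : Cube n) → 0ℚ ≤ℚ K (power (- v)) x y
  K-power-nonNeg []ᵛ []ᵛ = nonNegative⁻¹ 1ℚ
  K-power-nonNeg (s ∷ᵛ x) (t ∷ᵛ y) = subst (0ℚ ≤ℚ_) (sym eq) (*-nonNeg (factor s t) (K-power-nonNeg x y))
    where
    eq : K (power (- v)) (s ∷ᵛ x) (t ∷ᵛ y) ≡ (1ℚ - sgn s * sgn t * v) * K (power (- v)) x y
    eq = trans (cong (λ b → K (power (- v)) x y + sgn s * sgn t * b) (K-*ˡ (- v) (power (- v)) x y))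
      (solve 3 (λ a e v → a :+ e :* (:- v :* a) := (con 1ℚ :- e :* v) :* a) refl
        (K (power (- v)) x y) (sgn s * sgn t) v)
    0≤1+v : 0ℚ ≤ℚ 1ℚ - - 1ℚ * v
    0≤1+v = subst (0ℚ ≤ℚ_) (solve 1 (λ v → con 1ℚ :+ v := con 1ℚ :- con (- 1ℚ) :* v) refl v)
      (+-nonNeg (nonNegative⁻¹ 1ℚ) 0≤v)
    0≤1-1v : 0ℚ ≤ℚ 1ℚ - 1ℚ * v
    0≤1-1v = subst (λ z → 0ℚ ≤ℚ 1ℚ - z) (sym (*-identityˡ v)) 0≤1-v
    factor : ∀ s t → 0ℚ ≤ℚ 1ℚ - sgn s * sgn t * v
    factor Sign.+ Sign.+ = 0≤1-1v
    factor Sign.- Sign.- = 0≤1-1v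
    factor Sign.+ Sign.- = 0≤1+v
    factor Sign.- Sign.+ = 0≤1+v

  -- Both bounds are carried together because multiplication by -v exchanges them. Each new one is a
  -- combination (1 - v) + v (1 ± r) of nonnegative terms.
  0≤1±power : ∀ k → 0ℚ ≤ℚ 1ℚ - power (- v) k × 0ℚ ≤ℚ 1ℚ + power (- v) k
  0≤1±power zero = ≤-refl , nonNegative⁻¹ (1ℚ + 1ℚ)
  0≤1±power (suc k) with 0≤1-r , 0≤1+r ← 0≤1±power k =
    subst (0ℚ ≤ℚ_) (solve 2 (λ v r → (con 1ℚ :- v) :+ v :* (con 1ℚ :+ r) := con 1ℚ :- :- v :* r) refl v r)
      (+-nonNeg 0≤1-v (*-nonNeg 0≤v 0≤1+r)) ,
    subst (0ℚ ≤ℚ_) (solve 2 (λ v r → (con 1ℚ :- v) :+ v :* (con 1ℚ :- r) := con 1ℚ :+ :- v :* r) refl v r)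
      (+-nonNeg 0≤1-v (*-nonNeg 0≤v 0≤1-r))
    where
    r : ℚ
    r = power (- v) k

  -- v² - (-v)ᵏ corrected to 0 for k ≤ 1.
  coefficient : ℕ → ℚ
  coefficient k = ((v * v) * const1 k + - 1ℚ * power (- v) k) +
    ((1ℚ - v * v) * δ₀ k + - (v * v + v) * δ₁ k)

  -- The corrections make levels 0 and 1 vanish. At level k + 2 the value is v² (1 - (-v)ᵏ).
  coefficient-nonNeg : ∀ k → 0ℚ ≤ℚ coefficient k
  coefficient-nonNeg zero = ≤-reflexive (solve 1 (λ v →
    con 0ℚ := (v :* v :* con 1ℚ :+ con (- 1ℚ) :* con 1ℚ) :+
      ((con 1ℚ :- v :* v) :* con 1ℚ :+ :- (v :* v :+ v) :* con 0ℚ)) refl v)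
  coefficient-nonNeg (suc zero) = ≤-reflexive (solve 1 (λ v →
    con 0ℚ := (v :* v :* con 1ℚ :+ con (- 1ℚ) :* (:- v :* con 1ℚ)) :+
      ((con 1ℚ :- v :* v) :* con 0ℚ :+ :- (v :* v :+ v) :* con 1ℚ)) refl v)
  coefficient-nonNeg (suc (suc k)) with 0≤1-r , _ ← 0≤1±power k =
    subst (0ℚ ≤ℚ_) (solve 2 (λ v r → (v :* v) :* (con 1ℚ :- r) :=
      (v :* v :* con 1ℚ :+ con (- 1ℚ) :* (:- v :* (:- v :* r))) :+
      ((con 1ℚ :- v :* v) :* con 0ℚ :+ :- (v :* v :+ v) :* con 0ℚ)) refl v (power (- v) k))
      (*-nonNeg (square-nonNeg v) 0≤1-r)

  -- The right side exceeds the left by exactly `K (power (- v)) x y`, which is nonnegative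
  -- pointwise.
  K-coefficient-≤ : ∀ {n} (x y : Cube n) → K coefficient x y ≤ℚ
    (v * v) * K const1 x y + ((1ℚ - v * v - (v * v + v) * ι n) + (v * v + v) * ι 2 * ι (dᴴ x y))
  K-coefficient-≤ {n} x y = 0≤⇒≤ (K-power-nonNeg x y) (sym (trans
    (cong (λ z → R - z) eq)
    (solve 5 (λ v w p N d →
      ((v :* v) :* w :+ ((con 1ℚ :- v :* v :- (v :* v :+ v) :* N) :+ (v :* v :+ v) :* con (ι 2) :* d)) :-
      (((v :* v) :* w :+ con (- 1ℚ) :* p) :+
        ((con 1ℚ :- v :* v) :* con 1ℚ :+ :- (v :* v :+ v) :* (N :+ con (- ι 2) :* d))) := p) refl
      v (K const1 x y) (K (power (- v)) x y) (ι n) (ι (dᴴ x y)))))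
    where
    R : ℚ
    R = (v * v) * K const1 x y + ((1ℚ - v * v - (v * v + v) * ι n) + (v * v + v) * ι 2 * ι (dᴴ x y))
    eq : K coefficient x y ≡ ((v * v) * K const1 x y + - 1ℚ * K (power (- v)) x y) +
      ((1ℚ - v * v) * 1ℚ + - (v * v + v) * (ι n + - ι 2 * ι (dᴴ x y)))
    eq = trans (K-+ _ _ x y) (cong₂ _+_
      (trans (K-+ _ _ x y) (cong₂ _+_ (K-*ˡ (v * v) const1 x y) (K-*ˡ (- 1ℚ) (power (- v)) x y)))
      (trans (K-+ _ _ x y) (cong₂ _+_
        (trans (K-*ˡ (1ℚ - v * v) δ₀ x y) (cong (_*_ (1ℚ - v * v)) (K-δ₀ x y)))
        (trans (K-*ˡ (- (v * v + v)) δ₁ x y) (cong (_*_ (- (v * v + v))) (K-δ₁ x y))))))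

  -- Sums the kernel of `coefficient` over all pairs of codewords: positive semidefiniteness with
  -- unit weights bounds the sum below by 0, and `K-coefficient-≤` bounds it above.
  total-distance-≥ : ∀ {n} (A : Code n) → let m = ι ∣ A ∣ in
    0ℚ ≤ℚ (v * v) * (ι (2 ^ n) * m) + ((1ℚ - v * v - (v * v + v) * ι n) * (m * m) +
      (v * v + v) * ι 2 * ι (sum (map (uncurry dᴴ) (cartesianProduct (elements A) (elements A)))))
  total-distance-≥ {n} A = ≤-trans
    (K-positive-semidefinite n coefficient coefficient-nonNeg xs (λ x → x) (λ _ → 1ℚ))
    (≤-trans (∑-mono xs (λ x → ∑-mono xs (λ y →
        subst (_≤ℚ H x y) (solve 1 (λ z → z := con 1ℚ :* con 1ℚ :* z) refl (K coefficient x y))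
          (K-coefficient-≤ x y))))
      (≤-reflexive eq))
    where
    xs : List (Cube n)
    xs = elements A
    α β γ : ℚ
    α = v * v
    β = 1ℚ - v * v - (v * v + v) * ι n
    γ = (v * v + v) * ι 2
    H : Cube n → Cube n → ℚ
    H x y = α * K const1 x y + (β + γ * ι (dᴴ x y))
    eq : ∑ xs (λ x → ∑ xs (H x)) ≡ α * (ι (2 ^ n) * ι ∣ A ∣) + (β * (ι ∣ A ∣ * ι ∣ A ∣) +
      γ * ι (sum (map (uncurry dᴴ) (cartesianProduct xs xs))))
    eq = trans (∑∑-+ xs (λ x y → α * K const1 x y) (λ x y → β + γ * ι (dᴴ x y))) (cong₂ _+_
      (trans (∑∑-*ˡ xs α (K const1)) (cong (_*_ α)
        (∑∑-diagonal K-const1-diagonal K-const1-off-diagonal (elements-unique A))))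
      (trans (∑∑-+ xs (λ _ _ → β) (λ x y → γ * ι (dᴴ x y))) (cong₂ _+_
        (∑∑-const xs β)
        (trans (∑∑-*ˡ xs γ (λ x y → ι (dᴴ x y))) (cong (_*_ γ)
          (trans (sym (∑-cartesianProduct xs xs (ι ∘ uncurry dᴴ)))
            (∑-ι (cartesianProduct xs xs) (uncurry dᴴ))))))))

  -- Divides `total-distance-≥` by |A|². As `b` is the inverse of the density, 2ⁿ = b |A|.
  average-distance-≥ : ∀ {n} (A : Code n) .{{_ : ℕ.NonZero ∣ A ∣}} b → b * density n ∣ A ∣ ≡ 1ℚ →
    0ℚ ≤ℚ (v * v) * b + (1ℚ - v * v) - (v * v + v) * (ι 2 * (+ n / 2 - D A))
  average-distance-≥ {n} A b ba≡1 = *-cancelʳ-≤ (*-pos 0<m 0<m)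
    (subst₂ _≤ℚ_ (sym (*-zeroˡ (m * m))) eq (total-distance-≥ A))
    where
    m T S : ℚ
    m = ι ∣ A ∣
    T = ι (2 ^ n)
    S = ι (sum (map (uncurry dᴴ) (cartesianProduct (elements A) (elements A))))
    0<m : 0ℚ < m
    0<m = ι-pos ∣ A ∣
    T≡bm : T ≡ b * m
    T≡bm = begin
      T                             ≡⟨ *-identityˡ T ⟨
      1ℚ * T                        ≡⟨ cong (_* T) ba≡1 ⟨
      b * density n ∣ A ∣ * T       ≡⟨ *-assoc b (density n ∣ A ∣) T ⟩
      b * (density n ∣ A ∣ * T)     ≡⟨ cong (_*_ b) (/-*-ι ∣ A ∣ (2 ^ n) {{ℕ.m^n≢0 2 n}}) ⟩
      b * m                         ∎
      where open ≡-Reasoning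
    S≡Dm² : S ≡ D A * (m * m)
    S≡Dm² = trans
      (sym (/-*-ι (sum (map (uncurry dᴴ) (cartesianProduct (elements A) (elements A)))) (∣ A ∣ ^ 2)
        {{ℕ.m^n≢0 ∣ A ∣ 2}}))
      (cong (_*_ (D A)) (trans (cong (λ k → ι (∣ A ∣ ℕ.* k)) (ℕ.*-identityʳ ∣ A ∣)) (ι-* ∣ A ∣ ∣ A ∣)))
    eq : (v * v) * (T * m) + ((1ℚ - v * v - (v * v + v) * ι n) * (m * m) + (v * v + v) * ι 2 * S) ≡
      ((v * v) * b + (1ℚ - v * v) - (v * v + v) * (ι 2 * (+ n / 2 - D A))) * (m * m)
    eq = trans
      (cong₂ (λ T S → (v * v) * (T * m) +
        ((1ℚ - v * v - (v * v + v) * ι n) * (m * m) + (v * v + v) * ι 2 * S)) T≡bm S≡Dm²)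
      (trans (cong (λ N → (v * v) * (b * m * m) +
        ((1ℚ - v * v - (v * v + v) * N) * (m * m) + (v * v + v) * ι 2 * (D A * (m * m)))) (sym (/-*-ι n 2)))
      (solve 5 (λ v b m h d → (v :* v) :* (b :* m :* m) :+
        ((con 1ℚ :- v :* v :- (v :* v :+ v) :* (h :* con (ι 2))) :* (m :* m) :+
          (v :* v :+ v) :* con (ι 2) :* (d :* (m :* m))) :=
        ((v :* v) :* b :+ (con 1ℚ :- v :* v) :- (v :* v :+ v) :* (con (ι 2) :* (h :- d))) :* (m :* m)) refl
        v b m (+ n / 2) (D A)))

-- Choice of v and comparison with φ.

-- Here `g` stands for n / 2 - D(A). Testing it against every rational `u` above `φ a` means that
-- only rational witnesses from the upper cut are handled.
<φ : ∀ a .{{_ : Positive a}} {g u} →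
  (∀ {v} → 0ℚ ≤ℚ v → v ≤ℚ 1ℚ → ∀ b → b * a ≡ 1ℚ →
    0ℚ ≤ℚ (v * v) * b + (1ℚ - v * v) - (v * v + v) * (ι 2 * g)) →
  U (φ a) u → g < u
<φ a {g} {u} bound h with a ≤? + 1 / 4
... | no _ = ≤-<-trans g≤X h
  where
  instance
    nonZero = >-nonZero (*-pos (positive⁻¹ (+ 4 / 1)) (positive⁻¹ a))
  X : ℚ
  X = 1/ (+ 4 / 1 * a)
  b*a≡1 : ι 4 * X * a ≡ 1ℚ
  b*a≡1 = trans (solve 2 (λ X a → con (ι 4) :* X :* a := X :* (con (ι 4) :* a)) refl X a)
    (*-inverseˡ (+ 4 / 1 * a))
  g≤X : g ≤ℚ X
  -- At v = 1 the bound reads 0 ≤ b - 4 g, with b = 4 X.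
  g≤X = *-cancelʳ-≤ {r = ι 4} (ι-pos 4) (0≤⇒≤ (bound (nonNegative⁻¹ 1ℚ) ≤-refl (ι 4 * X) b*a≡1)
    (solve 2 (λ X g → (con 1ℚ :* con 1ℚ) :* (con (ι 4) :* X) :+ (con 1ℚ :- con 1ℚ :* con 1ℚ)
      :- (con 1ℚ :* con 1ℚ :+ con 1ℚ) :* (con (ι 2) :* g) := X :* con (ι 4) :- g :* con (ι 4)) refl X g))
-- Unfolding the cuts: `s` lies above 1 / √a, as witnessed by a positive `r` below √a with 1 < s r,
-- and `w` lies above -1. A negative `r` is impossible.
<φ a {g} {u} bound (s , w , (r , 0<r , inj₁ r<0 , 1<sr) , -w<1 , s+w<u) | yes a≤¼ =
  contradiction r<0 (<-asym 0<r)
<φ a {g} {u} bound (s , w , (r , 0<r , inj₂ r²<a , 1<sr) , -w<1 , s+w<u) | yes a≤¼ =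
  <-trans g<s-1 (<-trans s-1<s+w s+w<u)
  where
  instance
    nonZero = >-nonZero (positive⁻¹ a)
  b t : ℚ
  b = 1/ a
  t = s - 1ℚ
  0<s : 0ℚ < s
  0<s = *-cancelʳ-< 0<r (subst (_< s * r) (sym (*-zeroˡ r)) (<-trans (positive⁻¹ 1ℚ) 1<sr))
  -- Here a ≤ 1/4 enters: it yields s > 2, hence t > 1, so that v = 1 / t is admissible.
  r<½ : r < + 1 / 2
  r<½ with r <? + 1 / 2
  ... | yes r<½ = r<½
  ... | no  r≮½ = contradiction (<-≤-trans (<-≤-trans r²<a a≤¼) (≤-trans
    (*-monoʳ-≤-nonNeg (+ 1 / 2) (≮⇒≥ r≮½)) (*-monoˡ-≤-nonNeg r {{nonNegative (<⇒≤ 0<r)}} (≮⇒≥ r≮½))))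
    (<-irrefl refl)
  2<s : ι 2 < s
  2<s = *-cancelʳ-< {r = + 1 / 2} (positive⁻¹ (+ 1 / 2)) (<-trans 1<sr (*-monoʳ-<-pos s {{positive 0<s}} r<½))
  0<t : 0ℚ < t
  0<t = p<q⇒0<q-p (<-trans 1<2 2<s)
    where
    1<2 : 1ℚ < ι 2
    1<2 = 0<⇒< {1ℚ} (positive⁻¹ 1ℚ) refl
  b<s² : b < s * s
  -- From 1 < (s r)² < s² a, divided by a.
  b<s² = *-cancelʳ-< (positive⁻¹ a) (subst (_< s * s * a) (sym (*-inverseˡ a)) (<-trans 1<s²r²
    (*-monoʳ-<-pos (s * s) {{positive (*-pos 0<s 0<s)}} r²<a)))
    where
    1<s²r² : 1ℚ < s * s * (r * r)
    1<s²r² = subst (1ℚ <_) (solve 2 (λ s r → (s :* r) :* (s :* r) := s :* s :* (r :* r)) refl s r)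
      (<-trans 1<sr (subst (_< s * r * (s * r)) (*-identityˡ (s * r))
        (*-monoʳ-< (<-trans (positive⁻¹ 1ℚ) 1<sr) 1<sr)))
  instance
    t≢0 = >-nonZero 0<t
  -- If s were equal to 1 / √a, this v would minimise (v² (b - 1) + 1) / (v² + v), the upper bound
  -- on 2 g.
  v : ℚ
  v = 1/ t
  vt≡1 : v * t ≡ 1ℚ
  vt≡1 = *-inverseˡ t
  0≤v : 0ℚ ≤ℚ v
  0≤v = <⇒≤ (*-cancelʳ-< 0<t (subst₂ _<_ (sym (*-zeroˡ t)) (sym vt≡1) (positive⁻¹ 1ℚ)))
  v≤1 : v ≤ℚ 1ℚ
  v≤1 = *-cancelʳ-≤ 0<t (subst (_≤ℚ 1ℚ * t) (sym vt≡1) (<⇒≤ (0<⇒< (p<q⇒0<q-p 2<s)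
    (solve 1 (λ s → s :- con (ι 2) := con 1ℚ :* (s :- con 1ℚ) :- con 1ℚ) refl s))))
  -- The bound multiplied by t², with v t = 1 removing every v.
  scaled : 0ℚ ≤ℚ b + (t * t - 1ℚ) - (1ℚ + t) * (ι 2 * g)
  scaled = subst (0ℚ ≤ℚ_) (trans
    (solve 4 (λ v b t g → ((v :* v) :* b :+ (con 1ℚ :- v :* v) :- (v :* v :+ v) :* (con (ι 2) :* g)) :* (t :* t) :=
      (v :* t) :* (v :* t) :* b :+ (t :* t :- (v :* t) :* (v :* t)) :-
        ((v :* t) :* (v :* t) :+ (v :* t) :* t) :* (con (ι 2) :* g)) refl v b t g)
    (trans (cong (λ e → e * e * b + (t * t - e * e) - (e * e + e * t) * (ι 2 * g)) vt≡1)
      (solve 3 (λ b t g → con 1ℚ :* con 1ℚ :* b :+ (t :* t :- con 1ℚ :* con 1ℚ) :-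
        (con 1ℚ :* con 1ℚ :+ con 1ℚ :* t) :* (con (ι 2) :* g) :=
        b :+ (t :* t :- con 1ℚ) :- (con 1ℚ :+ t) :* (con (ι 2) :* g)) refl b t g)))
    (*-nonNeg (bound 0≤v v≤1 b (*-inverseˡ a)) (*-nonNeg (<⇒≤ 0<t) (<⇒≤ 0<t)))
  g<s-1 : g < s - 1ℚ
  -- Replacing b by the larger s² gives s² + (s - 1)² - 1 = 2 s (s - 1), while 1 + t = s, so 2 s g <
  -- 2 s (s - 1).
  g<s-1 = *-cancelʳ-< (*-pos 0<s (ι-pos 2)) (0<⇒< (+-mono-≤-< scaled (p<q⇒0<q-p b<s²))
    (solve 3 (λ b s g → (b :+ ((s :- con 1ℚ) :* (s :- con 1ℚ) :- con 1ℚ) :-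
        (con 1ℚ :+ (s :- con 1ℚ)) :* (con (ι 2) :* g)) :+ (s :* s :- b) :=
      (s :- con 1ℚ) :* (s :* con (ι 2)) :- g :* (s :* con (ι 2))) refl b s g))
  s-1<s+w : s - 1ℚ < s + w
  s-1<s+w = 0<⇒< (p<q⇒0<q-p -w<1)
    (solve 2 (λ s w → con 1ℚ :- :- w := (s :+ w) :- (s :- con 1ℚ)) refl s w)

theorem1 : (n M : ℕ) → 1 ≤ n → (1≤M : 1 ≤ M) → M ≤ 2 ^ (n ∸ 1) →
    (A : Code n) → (∣A∣≡M : ∣ A ∣ ≡ M) →
    D A {{nonEmpty {A = A} 1≤M ∣A∣≡M}} ᴿ
    ≥ᴿ (+ n / 2) ᴿ -ᴿ φ (density n M) {{density-positive n 1≤M}}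
theorem1 n M 1≤n 1≤M M≤2ⁿ⁻¹ A refl {q} (p , r , p<n/2 , φ<-r , q<p+r) =
  -- Since `p` is below n / 2 and `- r` is above φ, it suffices that n / 2 - D(A) < - r. Then p + r
  -- < D(A), and `q` lies below p + r.
  <-trans q<p+r (0<⇒< (+-mono-< (p<q⇒0<q-p p<n/2) (p<q⇒0<q-p n/2-D<-r))
    (solve 4 (λ h p d r → (h :- p) :+ (:- r :- (h :- d)) := d :- (p :+ r)) refl (+ n / 2) p (D A) r))
  where
  instance
    nonZero = nonEmpty {A = A} 1≤M refl
    pos = density-positive n 1≤M
  n/2-D<-r : + n / 2 - D A < - r
  n/2-D<-r = <φ (density n ∣ A ∣) (λ 0≤v v≤1 → average-distance-≥ 0≤v v≤1 A) φ<-r
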